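{- We have the $\mathrm{des}$-Wilf equivalence $\underline{231}4\overset{\mathrm{des}}{\sim}\underline{241}3$.
   Context: $\mathfrak{S}_n$ is the set of permutations of $\{1,\ldots,n\}$ in one-line notation, and $\mathrm{des}(\pi)=|\{i\in[n-1]:\pi_i>\pi_{i+1}\}|$. An occurrence of the pattern $\underline{abc}d$ (where $abcd\in\mathfrak{S}_4$) in $\pi$ is a subsequence $\pi_i\pi_{i+1}\pi_{i+2}\pi_j$ with $j>i+2$ order-isomorphic to $abcd$. $\mathfrak{S}_n(\omega)$ is the set of permutations in $\mathfrak{S}_n$ with no occurrence of $\omega$. $\omega\overset{\mathrm{des}}{\sim}\omega'$ means $|\{\pi\in\mathfrak{S}_n(\omega):\mathrm{des}(\pi)=m\}|=|\{\pi\in\mathfrak{S}_n(\omega'):\mathrm{des}(\pi)=m\}|$ for all $n\ge1$ and $m\ge0$. -}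

module Defs where

open import Data.Fin using (Fin; toℕ; _<_; #_)
open import Data.Fin.Properties using (_≟_; _<?_; any?; all?)
open import Data.List as List using (List; length; filter; allFin; cartesianProductWith)
open import Data.List.Membership.Propositional using (_∈_)
open import Data.List.Membership.Propositional.Properties using (∈-allFin; ∈-cartesianProductWith⁺)
open import Data.List.Relation.Unary.Any using (here)
import Data.List.Relation.Unary.All as ListAll
import Data.List.Relation.Unary.AllPairs as ListAllPairs
import Data.List.Relation.Unary.Unique.Propositional as ListUnique
open import Data.List.Relation.Unary.Unique.Propositional.Properties using (allFin⁺; cartesianProductWith⁺)
open import Data.Nat as ℕ using (ℕ; zero; suc; _≥_)
open import Data.Product using (∃-syntax; _×_; _,_)
open import Data.Vec using (Vec; []; _∷_; lookup)
open import Data.Vec.Properties using (∷-injective)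
open import Data.Vec.Relation.Unary.AllPairs using (allPairs?)
open import Data.Vec.Relation.Unary.Unique.Propositional using (Unique)
open import Function using (_⇔_; mk⇔; Equivalence)
open import Level using (0ℓ)
open import Relation.Binary.PropositionalEquality using (_≡_; refl)
open import Relation.Nullary using (Dec; ¬_; ¬?; _×-dec_; _→-dec_)
open import Relation.Nullary.Decidable using (map′)
open import Relation.Unary using (Pred; Decidable)

-- Letters and positions are 0-based throughout: the letter written a ∈ {1,…,n}
-- on paper is the element a - 1 of Fin n.

Word : ℕ → Set
Word n = Vec (Fin n) n

-- n distinct letters from an n-letter alphabet use each letter exactly once.
IsPermutation : ∀ {n} → Word n → Set
IsPermutation w = Unique w

isPermutation? : ∀ {n} → Decidable (IsPermutation {n})
isPermutation? = allPairs? (λ x y → ¬? (x ≟ y))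

-- The last position has no successor, hence is never a descent.
Descent : ∀ {n} → Word n → Fin n → Set
Descent w i = ∃[ j ] toℕ j ≡ suc (toℕ i) × lookup w j < lookup w i

descent? : ∀ {n} (w : Word n) → Decidable (Descent w)
descent? w i = any? λ j → (toℕ j ℕ.≟ suc (toℕ i)) ×-dec (lookup w j <? lookup w i)

des : ∀ {n} → Word n → ℕ
des {n} w = length (filter (descent? w) (allFin n))

OrderIsomorphic : ∀ {k m n} → Vec (Fin m) k → Vec (Fin n) k → Set
OrderIsomorphic {k} u v = (a b : Fin k) → (lookup u a < lookup u b) ⇔ (lookup v a < lookup v b)

orderIsomorphic? : ∀ {k m n} (u : Vec (Fin m) k) (v : Vec (Fin n) k) → Dec (OrderIsomorphic u v)
orderIsomorphic? u v = all? λ a → all? λ b →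
  (lookup u a <? lookup u b) ⇔-dec (lookup v a <? lookup v b)
  where
  _⇔-dec_ : ∀ {A B : Set} → Dec A → Dec B → Dec (A ⇔ B)
  A? ⇔-dec B? = map′ (λ (f , g) → mk⇔ f g)
                     (λ e → Equivalence.to e , Equivalence.from e)
                     ((A? →-dec B?) ×-dec (B? →-dec A?))

-- An occurrence of the pattern whose first three letters are underlined: they
-- must be matched at consecutive positions i₁, i₁ + 1, i₁ + 2, the fourth
-- anywhere to the right.
Occurs : ∀ {n} → Word 4 → Word n → Set
Occurs p w =
  ∃[ i₁ ] ∃[ i₂ ] ∃[ i₃ ] ∃[ j ]
    toℕ i₂ ≡ suc (toℕ i₁) × toℕ i₃ ≡ suc (toℕ i₂) × i₃ < j ×
    OrderIsomorphic (lookup w i₁ ∷ lookup w i₂ ∷ lookup w i₃ ∷ lookup w j ∷ []) p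

occurs? : ∀ {n} (p : Word 4) → Decidable (Occurs {n} p)
occurs? p w =
  any? λ i₁ → any? λ i₂ → any? λ i₃ → any? λ j →
    (toℕ i₂ ℕ.≟ suc (toℕ i₁)) ×-dec (toℕ i₃ ℕ.≟ suc (toℕ i₂)) ×-dec (i₃ <? j) ×-dec
    orderIsomorphic? (lookup w i₁ ∷ lookup w i₂ ∷ lookup w i₃ ∷ lookup w j ∷ []) p

-- Membership in 𝔖ₙ(p).
Avoiding : ∀ {n} → Word 4 → Word n → Set
Avoiding p w = IsPermutation w × ¬ Occurs p w

avoiding? : ∀ {n} (p : Word 4) → Decidable (Avoiding {n} p)
avoiding? p w = isPermutation? w ×-dec ¬? (occurs? p w)

allVecs : ∀ n k → List (Vec (Fin n) k)
allVecs n zero    = [] List.∷ List.[]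
allVecs n (suc k) = cartesianProductWith _∷_ (allFin n) (allVecs n k)

-- allVecs lists every vector exactly once, so that card below is a cardinality.
∈-allVecs : ∀ {n k} (v : Vec (Fin n) k) → v ∈ allVecs n k
∈-allVecs []      = here refl
∈-allVecs (x ∷ v) = ∈-cartesianProductWith⁺ _∷_ (∈-allFin x) (∈-allVecs v)

allVecs-unique : ∀ n k → ListUnique.Unique (allVecs n k)
allVecs-unique n zero    = ListAll.[] ListAllPairs.∷ ListAllPairs.[]
allVecs-unique n (suc k) =
  cartesianProductWith⁺ _∷_ ∷-injective (allFin⁺ n) (allVecs-unique n k)

card : ∀ {n} {P : Pred (Word n) 0ℓ} → Decidable P → ℕ
card {n} P? = length (filter P? (allVecs n n))

avoidersWithDes : Word 4 → ℕ → ℕ → ℕ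
avoidersWithDes p n m = card {n} (λ w → avoiding? p w ×-dec (des w ℕ.≟ m))

infix 4 _∼des_

_∼des_ : Word 4 → Word 4 → Set
p ∼des q = ∀ n → n ≥ 1 → ∀ m → avoidersWithDes p n m ≡ avoidersWithDes q n m

p2314 p2413 : Word 4
p2314 = # 1 ∷ # 2 ∷ # 0 ∷ # 3 ∷ []
p2413 = # 1 ∷ # 3 ∷ # 0 ∷ # 2 ∷ []

{-# OPTIONS --safe #-}
-- Write a permutation as its Lehmer code: the first letter, followed by the code
-- of the standardised tail.  If a b c are consecutive code entries, an occurrence
-- of either pattern starting there requires a peak c < a ≤ b.  Given a peak, the
-- fourth letter of 2314 is missing exactly when b is maximal, and that of 2413
-- exactly when b = a.  So avoidance prescribes the value of b at every peak, and
-- replacing one prescribed value by the other is a bijection.  Both values are at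
-- least a > c, so no peak is created or destroyed and the descents stay in place.
module Submission where

open import Defs

open import Data.Empty using (⊥; ⊥-elim)
open import Data.Fin using (Fin; zero; suc; toℕ; fromℕ; inject₁; punchIn; punchOut; _<_; #_)
open import Data.Fin.Properties using (_≟_; toℕ-injective; toℕ-fromℕ; toℕ-inject₁; toℕ<n; toℕ≤pred[n]; punchIn-injective; punchInᵢ≢i; punchIn-punchOut; punchIn-mono-≤; punchIn-cancel-≤; <-cmp; <-irrefl; <-asym; <⇒≢)
open import Data.List as List using (List; length; filter; allFin)
open import Data.List.Membership.Propositional using (_∈_)
open import Data.List.Membership.Propositional.Properties using (∈-∃++; ∈-++⁺ˡ; ∈-++⁺ʳ; ∈-++⁻; ∈-filter⁺; ∈-filter⁻)
open import Data.List.Properties using (length-++-sucʳ; filter-≐)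
open import Data.List.Relation.Unary.Any using (here; there)
import Data.List.Relation.Unary.All as ListAll
import Data.List.Relation.Unary.AllPairs as ListAllPairs
import Data.List.Relation.Unary.Unique.Propositional as ListUnique
import Data.List.Relation.Unary.Unique.Propositional.Properties as ListUniqueₚ
open import Data.Nat as ℕ using (ℕ; zero; suc; _≤_; z≤n; s≤s)
import Data.Nat.Properties as ℕₚ
open import Data.Product using (∃-syntax; _×_; _,_; proj₁; proj₂)
open import Data.Sum using (_⊎_; inj₁; inj₂; [_,_])
open import Data.Unit using (⊤; tt)
open import Data.Vec using (Vec; []; _∷_; lookup; map)
open import Data.Vec.Properties using (lookup-map; ∷-injectiveˡ; ∷-injectiveʳ)
open import Data.Vec.Relation.Unary.All as All using (All; []; _∷_)
import Data.Vec.Relation.Unary.All.Properties as Allₚ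
open import Data.Vec.Relation.Unary.AllPairs using ([]; _∷_)
open import Data.Vec.Relation.Unary.Unique.Propositional using (Unique)
import Data.Vec.Relation.Unary.Unique.Propositional.Properties as Uniqueₚ
open import Function using (_⇔_; mk⇔; Equivalence; _∘_; id)
open import Relation.Binary using (tri<; tri≈; tri>)
open import Relation.Binary.PropositionalEquality using (_≡_; _≢_; refl; sym; trans; cong; cong₂; subst; subst₂)
open import Relation.Nullary using (Dec; yes; no; ¬_; _×-dec_; contradiction)
open import Relation.Nullary.Decidable using (decidable-stable)
open import Relation.Unary using (_≐_)

open Equivalence using (to; from)

-- Counting

-- Induction on `xs`, deleting from `ys` the image of the head. A relation takes the place of a
-- function because the image of a word is computed from its code, which is available only through a
-- proof that the word is a permutation.
length-≤-by-injection : ∀ {A B : Set} (R : A → B → Set) →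
  (∀ {x x′ y} → R x y → R x′ y → x ≡ x′) →
  ∀ {xs : List A} (ys : List B) → ListUnique.Unique xs →
  (∀ {x} → x ∈ xs → ∃[ y ] y ∈ ys × R x y) → length xs ≤ length ys
length-≤-by-injection R inj ys ListAllPairs.[] image = z≤n
length-≤-by-injection R inj ys (x∉xs ListAllPairs.∷ xs!) image
  with image (here refl)
... | y , y∈ys , Rxy with ∈-∃++ y∈ys
... | us , vs , refl rewrite length-++-sucʳ us y vs =
  s≤s (length-≤-by-injection R inj (us List.++ vs) xs! image′)
  where
  image′ : ∀ {x′} → x′ ∈ _ → ∃[ y′ ] y′ ∈ us List.++ vs × R x′ y′
  image′ x′∈xs with image (there x′∈xs)
  ... | y′ , y′∈ys , Rx′y′ with ∈-++⁻ us y′∈ys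
  ... | inj₁ y′∈us         = y′ , ∈-++⁺ˡ y′∈us , Rx′y′
  ... | inj₂ (there y′∈vs) = y′ , ∈-++⁺ʳ us y′∈vs , Rx′y′
  -- The deleted element cannot serve a second time: injectivity would make `x′` equal to the head,
  -- against uniqueness.
  ... | inj₂ (here refl)   = contradiction (inj Rxy Rx′y′) (ListAll.lookup x∉xs x′∈xs)

-- Inserting a letter

map-injective : ∀ {A B : Set} {f : A → B} → (∀ {x y} → f x ≡ f y → x ≡ y) →
  ∀ {n} (xs ys : Vec A n) → map f xs ≡ map f ys → xs ≡ ys
map-injective f-inj []       []       eq = refl
map-injective f-inj (x ∷ xs) (y ∷ ys) eq =
  cong₂ _∷_ (f-inj (∷-injectiveˡ eq)) (map-injective f-inj xs ys (∷-injectiveʳ eq))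

unique-map⁻ : ∀ {A B : Set} {f : A → B} {n} (xs : Vec A n) → Unique (map f xs) → Unique xs
unique-map⁻         []       []         = []
unique-map⁻ {f = f} (x ∷ xs) (x∉ ∷ xs!) =
  All.map (λ fx≢fy x≡y → fx≢fy (cong f x≡y)) (Allₚ.map⁻ x∉) ∷ unique-map⁻ xs xs!

map-punchIn-preimage : ∀ {m} (a : Fin (suc m)) {n} (w : Vec (Fin (suc m)) n) →
  All (a ≢_) w → ∃[ v ] map (punchIn a) v ≡ w
map-punchIn-preimage a []      []         = [] , refl
map-punchIn-preimage a (x ∷ w) (a≢x ∷ a∉w) with map-punchIn-preimage a w a∉w
... | v , refl = punchOut a≢x ∷ v , cong (_∷ _) (punchIn-punchOut a≢x)

punchIn-below : ∀ {m} (a : Fin (suc m)) (b : Fin m) → toℕ b ℕ.< toℕ a → toℕ (punchIn a b) ≡ toℕ b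
punchIn-below (suc a) zero    b<a       = refl
punchIn-below (suc a) (suc b) (s≤s b<a) = cong suc (punchIn-below a b b<a)

punchIn-above : ∀ {m} (a : Fin (suc m)) (b : Fin m) → toℕ a ≤ toℕ b → toℕ (punchIn a b) ≡ suc (toℕ b)
punchIn-above zero    b       a≤b       = refl
punchIn-above (suc a) (suc b) (s≤s a≤b) = cong suc (punchIn-above a b a≤b)

punchIn-<⇔ : ∀ {m} (a : Fin (suc m)) (b : Fin m) → (punchIn a b < a) ⇔ (toℕ b ℕ.< toℕ a)
punchIn-<⇔ a b = mk⇔ below⁻ below⁺
  where
  below⁻ : punchIn a b < a → toℕ b ℕ.< toℕ a
  below⁻ B<a with toℕ b ℕ.<? toℕ a
  ... | yes b<a = b<a
  ... | no  b≮a = ⊥-elim (b≮a (ℕₚ.≤-trans (ℕₚ.n≤1+n _)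
          (subst (ℕ._< toℕ a) (punchIn-above a b (ℕₚ.≮⇒≥ b≮a)) B<a)))
  below⁺ : toℕ b ℕ.< toℕ a → punchIn a b < a
  below⁺ b<a = subst (ℕ._< toℕ a) (sym (punchIn-below a b b<a)) b<a

punchIn->⇔ : ∀ {m} (a : Fin (suc m)) (b : Fin m) → (a < punchIn a b) ⇔ (toℕ a ≤ toℕ b)
punchIn->⇔ a b = mk⇔
  (λ a<B → ℕₚ.≮⇒≥ λ b<a → <-asym {x = a} {y = punchIn a b} a<B (from (punchIn-<⇔ a b) b<a))
  (λ a≤b → subst (toℕ a ℕ.<_) (sym (punchIn-above a b a≤b)) (s≤s a≤b))

Embedding : ∀ {m n} → (Fin m → Fin n) → Set
Embedding f = ∀ x y → (x < y) ⇔ (f x < f y)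

punchIn-embedding : ∀ {m} (a : Fin (suc m)) → Embedding (punchIn a)
punchIn-embedding a x y = mk⇔
  (λ x<y → ℕₚ.≰⇒> λ fy≤fx → ℕₚ.<⇒≱ x<y (punchIn-cancel-≤ a y x fy≤fx))
  (λ fx<fy → ℕₚ.≰⇒> λ y≤x → ℕₚ.<⇒≱ fx<fy (punchIn-mono-≤ a y x y≤x))

-- Descents and occurrences for words over an arbitrary alphabet

-- Removing the first letter leaves a tail over an alphabet larger than its length, so the induction
-- needs the two sizes to be independent. At equal sizes `Descentᵥ` and `Occursᵥ` unfold to
-- `Descent` and `Occurs`.
Descentᵥ : ∀ {m n} → Vec (Fin m) n → Fin n → Set
Descentᵥ w i = ∃[ j ] toℕ j ≡ suc (toℕ i) × lookup w j < lookup w i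

Occursᵥ : ∀ {m n} → Word 4 → Vec (Fin m) n → Set
Occursᵥ p w =
  ∃[ i₁ ] ∃[ i₂ ] ∃[ i₃ ] ∃[ j ]
    toℕ i₂ ≡ suc (toℕ i₁) × toℕ i₃ ≡ suc (toℕ i₂) × i₃ < j ×
    OrderIsomorphic (lookup w i₁ ∷ lookup w i₂ ∷ lookup w i₃ ∷ lookup w j ∷ []) p

Starts : ∀ {m n} → Word 4 → Vec (Fin m) (3 ℕ.+ n) → Set
Starts p (x ∷ y ∷ z ∷ w) = ∃[ j ] OrderIsomorphic (x ∷ y ∷ z ∷ lookup w j ∷ []) p

descent-map : ∀ {m m′ n} {f : Fin m → Fin m′} → Embedding f → (w : Vec (Fin m) n) →
  Descentᵥ (map f w) ≐ Descentᵥ w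
descent-map {f = f} emb w = (λ {i} → forth {i}) , (λ {i} → back {i})
  where
  forth : ∀ {i} → Descentᵥ (map f w) i → Descentᵥ w i
  forth {i} (j , eq , d) rewrite lookup-map j f w | lookup-map i f w = j , eq , from (emb (lookup w j) (lookup w i)) d
  back : ∀ {i} → Descentᵥ w i → Descentᵥ (map f w) i
  back {i} (j , eq , d) = j , eq ,
    subst₂ _<_ (sym (lookup-map j f w)) (sym (lookup-map i f w)) (to (emb (lookup w j) (lookup w i)) d)

orderIso-map : ∀ {k m m′ n} {f : Fin m → Fin m′} → Embedding f →
  (u : Vec (Fin m) k) (v : Vec (Fin n) k) → OrderIsomorphic (map f u) v ⇔ OrderIsomorphic u v
orderIso-map {f = f} emb u v = mk⇔ forth back
  where
  forth : OrderIsomorphic (map f u) v → OrderIsomorphic u v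
  forth iso a b with iso a b
  ... | ab rewrite lookup-map a f u | lookup-map b f u =
    mk⇔ (to ab ∘ to x<y⇔) (from x<y⇔ ∘ from ab)
    where x<y⇔ = emb (lookup u a) (lookup u b)
  back : OrderIsomorphic u v → OrderIsomorphic (map f u) v
  back iso a b rewrite lookup-map a f u | lookup-map b f u =
    mk⇔ (to (iso a b) ∘ from x<y⇔) (to x<y⇔ ∘ from (iso a b))
    where x<y⇔ = emb (lookup u a) (lookup u b)

occurs-map : ∀ {m m′ n} {f : Fin m → Fin m′} → Embedding f → (p : Word 4) (w : Vec (Fin m) n) →
  Occursᵥ p (map f w) ⇔ Occursᵥ p w
occurs-map {f = f} emb p w = mk⇔ forth back
  where
  forth : Occursᵥ p (map f w) → Occursᵥ p w
  forth (i₁ , i₂ , i₃ , j , e₁ , e₂ , lt , iso)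
    rewrite lookup-map i₁ f w | lookup-map i₂ f w | lookup-map i₃ f w | lookup-map j f w =
    i₁ , i₂ , i₃ , j , e₁ , e₂ , lt , to (orderIso-map emb (lookup w i₁ ∷ lookup w i₂ ∷ lookup w i₃ ∷ lookup w j ∷ []) p) iso
  back : Occursᵥ p w → Occursᵥ p (map f w)
  back (i₁ , i₂ , i₃ , j , e₁ , e₂ , lt , iso) =
    i₁ , i₂ , i₃ , j , e₁ , e₂ , lt , iso′
    where
    iso′ : OrderIsomorphic (lookup (map f w) i₁ ∷ lookup (map f w) i₂ ∷ lookup (map f w) i₃ ∷ lookup (map f w) j ∷ []) p
    iso′ rewrite lookup-map i₁ f w | lookup-map i₂ f w | lookup-map i₃ f w | lookup-map j f w =
      from (orderIso-map emb (lookup w i₁ ∷ lookup w i₂ ∷ lookup w i₃ ∷ lookup w j ∷ []) p) iso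

short-no-occurrence : ∀ {m n} (p : Word 4) (w : Vec (Fin m) n) → n ≤ 2 → ¬ Occursᵥ p w
short-no-occurrence {n = n} p w n≤2 (i₁ , i₂ , i₃ , j , e₁ , e₂ , lt , iso) =
  ℕₚ.<⇒≱ (ℕₚ.<-≤-trans (toℕ<n i₃) n≤2)
    (subst (2 ≤_) (sym (trans e₂ (cong suc e₁))) (s≤s (s≤s z≤n)))

occurs-∷⁻ : ∀ {m n} (p : Word 4) (x : Fin m) (w : Vec (Fin m) (2 ℕ.+ n)) →
  Occursᵥ p (x ∷ w) → Starts p (x ∷ w) ⊎ Occursᵥ p w
occurs-∷⁻ p x (y ∷ z ∷ w) (zero , suc zero , suc (suc zero) , suc (suc (suc j)) , e₁ , e₂ , lt , iso) =
  inj₁ (j , iso)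
occurs-∷⁻ p x (y ∷ z ∷ w) (zero , suc zero , suc (suc zero) , suc zero , e₁ , e₂ , s≤s () , iso)
occurs-∷⁻ p x (y ∷ z ∷ w) (zero , suc zero , suc (suc zero) , suc (suc zero) , e₁ , e₂ , s≤s (s≤s ()) , iso)
occurs-∷⁻ p x w (suc i₁ , suc i₂ , suc i₃ , suc j , e₁ , e₂ , s≤s lt , iso) =
  inj₂ (i₁ , i₂ , i₃ , j , ℕₚ.suc-injective e₁ , ℕₚ.suc-injective e₂ , lt , iso)

occurs-∷⁺ : ∀ {m n} (p : Word 4) (x : Fin m) (w : Vec (Fin m) (2 ℕ.+ n)) →
  Starts p (x ∷ w) ⊎ Occursᵥ p w → Occursᵥ p (x ∷ w)
occurs-∷⁺ p x (y ∷ z ∷ w) (inj₁ (j , iso)) =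
  zero , suc zero , suc (suc zero) , suc (suc (suc j)) , refl , refl , s≤s (s≤s (s≤s z≤n)) , iso
occurs-∷⁺ p x w (inj₂ (i₁ , i₂ , i₃ , j , e₁ , e₂ , lt , iso)) =
  suc i₁ , suc i₂ , suc i₃ , suc j , cong suc e₁ , cong suc e₂ , s≤s lt , iso

-- Lehmer codes

-- Each entry is the rank of its letter among the letters from there on, so its range shrinks by one
-- at every step.
data Code : ℕ → Set where
  []  : Code 0
  _∷_ : ∀ {n} → Fin (suc n) → Code n → Code (suc n)

decode : ∀ {n} → Code n → Word n
decode []      = []
decode (a ∷ s) = a ∷ map (punchIn a) (decode s)

decode-unique : ∀ {n} (s : Code n) → Unique (decode s)
decode-unique []      = []
decode-unique (a ∷ s) =
  Allₚ.map⁺ (All.universal (λ x → punchInᵢ≢i a x ∘ sym) (decode s))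
  ∷ Uniqueₚ.map⁺ (punchIn-injective a _ _) (decode-unique s)

decode-injective : ∀ {n} (s t : Code n) → decode s ≡ decode t → s ≡ t
decode-injective []      []      eq = refl
decode-injective (a ∷ s) (b ∷ t) eq with ∷-injectiveˡ eq
... | refl = cong (a ∷_)
  (decode-injective s t (map-injective (punchIn-injective a _ _) _ _ (∷-injectiveʳ eq)))

encode : ∀ {n} (w : Word n) → Unique w → ∃[ s ] decode s ≡ w
encode []      []         = [] , refl
encode (a ∷ w) (a∉w ∷ w!) with map-punchIn-preimage a w a∉w
... | v , refl with encode v (unique-map⁻ v w!)
... | s , refl = a ∷ s , refl

-- Supplies the fourth letter of an occurrence: a letter different from the first three must sit at
-- some later position.
decode-surjective : ∀ {n} (s : Code n) (x : Fin n) → ∃[ i ] lookup (decode s) i ≡ x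
decode-surjective (a ∷ s) x with a ≟ x
... | yes a≡x = zero , a≡x
... | no  a≢x with decode-surjective s (punchOut a≢x)
... | i , eq = suc i , trans (lookup-map i (punchIn a) (decode s))
                             (trans (cong (punchIn a) eq) (punchIn-punchOut a≢x))

-- The pass exchanging the values at the peaks

-- In letters: third < first < second. The inequality between `a` and `b` is weak because `b` is a
-- rank taken after deletion of the first letter.
Peak : ∀ {k l m} → Fin k → Fin l → Fin m → Set
Peak a b c = toℕ c ℕ.< toℕ a × toℕ a ≤ toℕ b

peak? : ∀ {k l m} (a : Fin k) (b : Fin l) (c : Fin m) → Dec (Peak a b c)
peak? a b c = (toℕ c ℕ.<? toℕ a) ×-dec (toℕ a ℕ.≤? toℕ b)

-- The prescribed entry depends on `a` alone, so it can still be computed once `b` has been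
-- overwritten. In `above`, the argument `b` certifies that `a` is not the top of its range, which
-- no entry in the range of `b` could reach.
record PeakValue : Set where
  field
    value : ∀ {n} → Fin (suc (suc n)) → Fin (suc n)
    above : ∀ {n} (a : Fin (suc (suc n))) (b : Fin (suc n)) → toℕ a ≤ toℕ b → toℕ a ≤ toℕ (value a)

open PeakValue

adjust : PeakValue → ∀ {n} → Fin (suc (suc n)) → Fin (suc n) → Code n → Fin (suc n)
adjust e a b []      = b
adjust e a b (c ∷ s) with peak? a b c
... | yes _ = value e a
... | no  _ = b

-- Each test sees the adjusted left neighbour but the original right one. By `pass-adjust`, the
-- original left neighbour would give the same result.
pass : PeakValue → ∀ {n} → Fin (suc n) → Code n → Code n
pass e a []      = []
pass e a (b ∷ s) = adjust e a b s ∷ pass e (adjust e a b s) s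

Tolerated : PeakValue → ∀ {n} → Fin (suc (suc n)) → Fin (suc n) → Code n → Set
Tolerated e a b []      = ⊤
Tolerated e a b (c ∷ s) = Peak a b c → b ≡ value e a

Good : PeakValue → ∀ {n} → Fin (suc n) → Code n → Set
Good e a []      = ⊤
Good e a (b ∷ s) = Tolerated e a b s × Good e b s

Falls : ∀ {n} → Fin (suc n) → Code n → Set
Falls a []      = ⊥
Falls a (b ∷ s) = toℕ b ℕ.< toℕ a

adjust-above : ∀ e {n} (a : Fin (suc (suc n))) (b : Fin (suc n)) (s : Code n) →
  toℕ a ≤ toℕ b → toℕ a ≤ toℕ (adjust e a b s)
adjust-above e a b []      a≤b = a≤b
adjust-above e a b (c ∷ s) a≤b with peak? a b c
... | yes _ = above e a b a≤b
... | no  _ = a≤b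

adjust-below : ∀ e {n} (a : Fin (suc (suc n))) (b : Fin (suc n)) (s : Code n) →
  toℕ b ℕ.< toℕ a → adjust e a b s ≡ b
adjust-below e a b []      b<a = refl
adjust-below e a b (c ∷ s) b<a with peak? a b c
... | yes (_ , a≤b) = contradiction a≤b (ℕₚ.<⇒≱ b<a)
... | no  _         = refl

adjust-peak : ∀ e {n} (a : Fin (3 ℕ.+ n)) (b : Fin (2 ℕ.+ n)) (c : Fin (suc n)) (s : Code n) →
  Peak a b c → adjust e a b (c ∷ s) ≡ value e a
adjust-peak e a b c s pk with peak? a b c
... | yes _  = refl
... | no ¬pk = contradiction pk ¬pk

adjust-no-peak : ∀ e {n} (a : Fin (3 ℕ.+ n)) (b : Fin (2 ℕ.+ n)) (c : Fin (suc n)) (s : Code n) →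
  ¬ Peak a b c → adjust e a b (c ∷ s) ≡ b
adjust-no-peak e a b c s ¬pk with peak? a b c
... | yes pk = contradiction pk ¬pk
... | no _   = refl

-- If `c` is at least `b`, its adjusted value is at least `b` too, hence not below `a`; if `c` is
-- below `b`, it does not move.
no-peak-after-adjust : ∀ e {n} (a : Fin (3 ℕ.+ n)) (b : Fin (2 ℕ.+ n)) (c : Fin (suc n)) (s : Code n) →
  ¬ Peak a b c → ¬ Peak a b (adjust e b c s)
no-peak-after-adjust e a b c s ¬pk (c′<a , a≤b) with toℕ b ℕ.≤? toℕ c
... | yes b≤c = ℕₚ.<⇒≱ c′<a (ℕₚ.≤-trans a≤b (adjust-above e b c s b≤c))
... | no  b≰c = ¬pk (subst (λ x → toℕ x ℕ.< toℕ a) (adjust-below e b c s (ℕₚ.≰⇒> b≰c)) c′<a , a≤b)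

-- Only a peak changes `b`, and there the next entry lies below `a`, hence below the old and the new
-- value alike. That next entry is therefore not the middle of a peak itself.
adjust-unchanged⊎falls : ∀ e {n} (a : Fin (suc (suc n))) (b : Fin (suc n)) (s : Code n) →
  adjust e a b s ≡ b ⊎ (Falls (adjust e a b s) s × Falls b s)
adjust-unchanged⊎falls e a b []      = inj₁ refl
adjust-unchanged⊎falls e a b (c ∷ s) with peak? a b c
... | yes (c<a , a≤b) = inj₂ (ℕₚ.<-≤-trans c<a (above e a b a≤b) , ℕₚ.<-≤-trans c<a a≤b)
... | no  _           = inj₁ refl

-- The preceding entry influences a pass only through the first test. An entry below it fails that
-- test, and the rest is computed from that entry alone.
pass-falls : ∀ e {n} (a b : Fin (suc n)) (s : Code n) → Falls a s → Falls b s → pass e a s ≡ pass e b s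
pass-falls e a b (c ∷ s) c<a c<b =
  cong (λ x → x ∷ pass e x s) (trans (adjust-below e a c s c<a) (sym (adjust-below e b c s c<b)))

pass-adjust : ∀ e {n} (a : Fin (suc (suc n))) (b : Fin (suc n)) (s : Code n) →
  pass e (adjust e a b s) s ≡ pass e b s
pass-adjust e a b s with adjust-unchanged⊎falls e a b s
... | inj₁ eq         = cong (λ x → pass e x s) eq
... | inj₂ (fa , fb) = pass-falls e _ b s fa fb

pass-tolerated : ∀ e {n} (a : Fin (suc (suc n))) (b : Fin (suc n)) (s : Code n) →
  Tolerated e a (adjust e a b s) (pass e (adjust e a b s) s)
pass-tolerated e a b []      = tt
pass-tolerated e a b (c ∷ s) with peak? a b c
... | yes _  = λ _ → refl
... | no ¬pk = λ pk → contradiction pk (no-peak-after-adjust e a b c s ¬pk)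

pass-good : ∀ e {n} (a : Fin (suc n)) (s : Code n) → Good e a (pass e a s)
pass-good e a []      = tt
pass-good e a (b ∷ s) = pass-tolerated e a b s , pass-good e (adjust e a b s) s

-- At a peak the pass for `e′` leaves `c` alone, so the pass for `e` meets a peak again and writes
-- `value e a`, which `b` was by tolerance. Elsewhere both passes keep `b`.
adjust-inverse : ∀ e e′ {n} (a : Fin (suc (suc n))) (b : Fin (suc n)) (s : Code n) → Tolerated e a b s →
  adjust e a (adjust e′ a b s) (pass e′ (adjust e′ a b s) s) ≡ b
adjust-inverse e e′ a b []      tol = refl
adjust-inverse e e′ a b (c ∷ s) tol with peak? a b c
... | no ¬pk = adjust-no-peak e a b (adjust e′ b c s) (pass e′ (adjust e′ b c s) s)
  (no-peak-after-adjust e′ a b c s ¬pk)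
... | yes (c<a , a≤b) =
  trans (adjust-peak e a (value e′ a) c′ (pass e′ c′ s) (c′<a , a≤e′)) (sym (tol (c<a , a≤b)))
  where
  c′ = adjust e′ (value e′ a) c s
  a≤e′ : toℕ a ≤ toℕ (value e′ a)
  a≤e′ = above e′ a b a≤b
  c′<a : toℕ c′ ℕ.< toℕ a
  c′<a rewrite adjust-below e′ (value e′ a) c s (ℕₚ.<-≤-trans c<a a≤e′) = c<a

pass-inverse : ∀ e e′ {n} (a : Fin (suc n)) (s : Code n) → Good e a s → pass e a (pass e′ a s) ≡ s
pass-inverse e e′ a []      good        = refl
pass-inverse e e′ a (b ∷ s) (tol , good)
  -- The head is restored first; `pass-adjust` then lets the inner pass start from `b` instead of
  -- its replacement, as the induction hypothesis demands.
  rewrite adjust-inverse e e′ a b s tol | pass-adjust e′ a b s =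
  cong (b ∷_) (pass-inverse e e′ b s good)

-- Invariance of the descents under the pass

falls-adjust : ∀ e {n} (a : Fin (suc (suc n))) (b : Fin (suc n)) (s : Code n) →
  Falls (adjust e a b s) s ⇔ Falls b s
falls-adjust e a b s with adjust-unchanged⊎falls e a b s
... | inj₁ eq rewrite eq = mk⇔ id id
... | inj₂ (fa , fb)     = mk⇔ (λ _ → fb) (λ _ → fa)

falls-pass : ∀ e {n} (a : Fin (suc n)) (s : Code n) → Falls a (pass e a s) ⇔ Falls a s
falls-pass e a []      = mk⇔ id id
falls-pass e a (b ∷ s) = mk⇔ forth back
  where
  forth : toℕ (adjust e a b s) ℕ.< toℕ a → toℕ b ℕ.< toℕ a
  forth b′<a = ℕₚ.≰⇒> λ a≤b → ℕₚ.<⇒≱ b′<a (adjust-above e a b s a≤b)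
  back : toℕ b ℕ.< toℕ a → toℕ (adjust e a b s) ℕ.< toℕ a
  back b<a rewrite adjust-below e a b s b<a = b<a

descent-zero : ∀ {n} (a : Fin (suc n)) (s : Code n) → Descentᵥ (decode (a ∷ s)) zero ⇔ Falls a s
descent-zero a []      = mk⇔ (λ { (zero , () , _) }) ⊥-elim
descent-zero a (b ∷ s) = mk⇔
  (λ { (suc zero , _ , B<a) → to (punchIn-<⇔ a b) B<a })
  (λ b<a → suc zero , refl , from (punchIn-<⇔ a b) b<a)

descent-suc : ∀ {n} (a : Fin (suc n)) (s : Code n) (i : Fin n) →
  Descentᵥ (decode (a ∷ s)) (suc i) ⇔ Descentᵥ (decode s) i
descent-suc a s i = mk⇔
  (λ { (suc j , eq , d) → proj₁ descents {i} (j , ℕₚ.suc-injective eq , d) })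
  (λ d → suc (proj₁ (back d)) , cong suc (proj₁ (proj₂ (back d))) , proj₂ (proj₂ (back d)))
  where
  descents : Descentᵥ (map (punchIn a) (decode s)) ≐ Descentᵥ (decode s)
  descents = descent-map (punchIn-embedding a) (decode s)
  back : Descentᵥ (decode s) i → Descentᵥ (map (punchIn a) (decode s)) i
  back = proj₂ descents {i}

-- The two heads may differ as long as both fall or neither does: after one step the recursion
-- compares `b` with its adjusted form, for which `falls-adjust` provides this condition.
pass-descent : ∀ e {n} (a a′ : Fin (suc n)) (s : Code n) → Falls a′ s ⇔ Falls a s →
  ∀ i → Descentᵥ (decode (a′ ∷ pass e a′ s)) i ⇔ Descentᵥ (decode (a ∷ s)) i
pass-descent e a a′ s fall zero = mk⇔
  (from (descent-zero a s) ∘ to fall ∘ to (falls-pass e a′ s) ∘ to (descent-zero a′ (pass e a′ s)))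
  (from (descent-zero a′ (pass e a′ s)) ∘ from (falls-pass e a′ s) ∘ from fall ∘ to (descent-zero a s))
pass-descent e a a′ (b ∷ s) fall (suc i) = mk⇔
  (from (descent-suc a (b ∷ s) i) ∘ to IH ∘ to (descent-suc a′ (pass e a′ (b ∷ s)) i))
  (from (descent-suc a′ (pass e a′ (b ∷ s)) i) ∘ from IH ∘ to (descent-suc a (b ∷ s) i))
  where
  IH : Descentᵥ (decode (pass e a′ (b ∷ s))) i ⇔ Descentᵥ (decode (b ∷ s)) i
  IH = pass-descent e b (adjust e a′ b s) s (falls-adjust e a′ b s) i

pass-des : ∀ e {n} (a : Fin (suc n)) (s : Code n) → des (decode (a ∷ pass e a s)) ≡ des (decode (a ∷ s))
pass-des e a s = cong length (filter-≐ (descent? (decode (a ∷ pass e a s))) (descent? (decode (a ∷ s)))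
  ((λ {i} → to (pass-descent e a a s (mk⇔ id id) i)) , (λ {i} → from (pass-descent e a a s (mk⇔ id id) i)))
  (allFin _))

-- Avoidance in terms of codes

-- All that the bijection has to know about a pattern; the counting argument is uniform in it.
record CodeCriterion (p : Word 4) : Set where
  field
    peakValue : PeakValue
    starts⇔   : ∀ {n} (a : Fin (3 ℕ.+ n)) (b : Fin (2 ℕ.+ n)) (c : Fin (suc n)) (s : Code n) →
      Starts p (decode (a ∷ b ∷ c ∷ s)) ⇔ (Peak a b c × b ≢ value peakValue a)

open CodeCriterion

good⇒avoids : ∀ {p} (k : CodeCriterion p) {n} (a : Fin (suc n)) (s : Code n) →
  Good (peakValue k) a s → ¬ Occursᵥ p (decode (a ∷ s))
good⇒avoids {p} k a []          good occ = short-no-occurrence p (decode (a ∷ [])) (s≤s z≤n) occ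
good⇒avoids {p} k a (b ∷ [])    good occ = short-no-occurrence p (decode (a ∷ b ∷ [])) (s≤s (s≤s z≤n)) occ
good⇒avoids {p} k a (b ∷ c ∷ s) (tol , good) occ =
  [ (λ st → let pk , b≢e = to (starts⇔ k a b c s) st in b≢e (tol pk))
  , (λ o → good⇒avoids k b (c ∷ s) good (to (occurs-map (punchIn-embedding a) p (decode (b ∷ c ∷ s))) o))
  ] (occurs-∷⁻ p a (map (punchIn a) (decode (b ∷ c ∷ s))) occ)

avoids⇒good : ∀ {p} (k : CodeCriterion p) {n} (a : Fin (suc n)) (s : Code n) →
  ¬ Occursᵥ p (decode (a ∷ s)) → Good (peakValue k) a s
avoids⇒good k a []          av = tt
avoids⇒good k a (b ∷ [])    av = tt , tt
avoids⇒good {p} k a (b ∷ c ∷ s) av =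
  (λ pk → decidable-stable (b ≟ _) λ b≢ →
     av (occurs-∷⁺ p a (map (punchIn a) (decode (b ∷ c ∷ s))) (inj₁ (from (starts⇔ k a b c s) (pk , b≢))))) ,
  avoids⇒good k b (c ∷ s) λ o →
     av (occurs-∷⁺ p a (map (punchIn a) (decode (b ∷ c ∷ s)))
       (inj₂ (from (occurs-map (punchIn-embedding a) p (decode (b ∷ c ∷ s))) o)))

-- Sending avoiders of one pattern to avoiders of the other

Transported : PeakValue → PeakValue → ∀ {n} → Word (suc n) → Word (suc n) → Set
Transported e e′ w v = ∃[ a ] ∃[ s ] Good e a s × w ≡ decode (a ∷ s) × v ≡ decode (a ∷ pass e′ a s)

-- Words determine their codes, and `Good` lets the pass for `e` recover `s` from the image; this is
-- why goodness is recorded in `Transported`.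
transported-injective : ∀ e e′ {n} {w w′ v : Word (suc n)} →
  Transported e e′ w v → Transported e e′ w′ v → w ≡ w′
transported-injective e e′ (a , s , good , refl , refl) (a₁ , s₁ , good₁ , refl , eq)
  with decode-injective (a ∷ pass e′ a s) (a₁ ∷ pass e′ a₁ s₁) eq
... | eq′ with ∷-injectiveˡ eq
... | refl = cong (λ t → decode (a ∷ t))
  (trans (sym (pass-inverse e e′ a s good))
    (trans (cong (pass e a) (tail-injective eq′)) (pass-inverse e e′ a s₁ good₁)))
  where
  tail-injective : ∀ {n} {x y : Fin (suc n)} {t u : Code n} → _≡_ {A = Code (suc n)} (x ∷ t) (y ∷ u) → t ≡ u
  tail-injective refl = refl

transport : ∀ {p q} (k : CodeCriterion p) (l : CodeCriterion q) {n} {w : Word (suc n)} → Avoiding p w →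
  ∃[ v ] Avoiding q v × des v ≡ des w × Transported (peakValue k) (peakValue l) w v
transport {p} {q} k l {n} {w} (w! , av) = via (encode w w!) av
  where
  -- Restated for a variable word, so that matching on the equation can replace it by a decoded
  -- code.
  via : ∀ {w} → ∃[ s ] decode s ≡ w → ¬ Occursᵥ p w →
    ∃[ v ] Avoiding q v × des v ≡ des w × Transported (peakValue k) (peakValue l) w v
  via (a ∷ s , refl) av =
    decode (a ∷ t) , (decode-unique (a ∷ t) , good⇒avoids l a t (pass-good (peakValue l) a s)) ,
    pass-des (peakValue l) a s , a , s , avoids⇒good k a s av , refl , refl
    where
    t : Code n
    t = pass (peakValue l) a s

-- The pass keeps `des`, so it injects the avoiders counted on the left into those counted on the
-- right. Exchanging the two criteria yields the reverse inequality.
avoidersWithDes-≤ : ∀ {p q} → CodeCriterion p → CodeCriterion q → ∀ n m →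
  avoidersWithDes p (suc n) m ≤ avoidersWithDes q (suc n) m
avoidersWithDes-≤ {p} {q} k l n m =
  length-≤-by-injection R (transported-injective (peakValue k) (peakValue l)) (filter Q? words)
    (ListUniqueₚ.filter⁺ P? (allVecs-unique (suc n) (suc n))) image
  where
  R : Word (suc n) → Word (suc n) → Set
  R = Transported (peakValue k) (peakValue l)
  words : List (Word (suc n))
  words = allVecs (suc n) (suc n)
  P? : ∀ w → Dec (Avoiding p w × des w ≡ m)
  P? w = avoiding? p w ×-dec (des w ℕ.≟ m)
  Q? : ∀ w → Dec (Avoiding q w × des w ≡ m)
  Q? w = avoiding? q w ×-dec (des w ℕ.≟ m)
  image : ∀ {w} → w ∈ filter P? words → ∃[ v ] v ∈ filter Q? words × R w v
  image w∈ =
    let _ , avoids , des≡m = ∈-filter⁻ P? {xs = words} w∈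
        v , avoids′ , same-des , r = transport k l avoids
    in v , ∈-filter⁺ Q? (∈-allVecs v) (avoids′ , trans same-des des≡m) , r

-- The two patterns

increasing-embedding : ∀ {m} (w x y z : Fin m) → w < x → x < y → y < z →
  Embedding (lookup (w ∷ x ∷ y ∷ z ∷ []))
increasing-embedding w x y z w<x x<y y<z i j = mk⇔ (mono i j) (cancel i j)
  where
  f : Fin 4 → Fin _
  f = lookup (w ∷ x ∷ y ∷ z ∷ [])
  mono : ∀ i j → i < j → f i < f j
  mono zero                zero                ()
  mono zero                (suc zero)          _ = w<x
  mono zero                (suc (suc zero))    _ = ℕₚ.<-trans w<x x<y
  mono zero                (suc (suc (suc zero))) _ = ℕₚ.<-trans w<x (ℕₚ.<-trans x<y y<z)
  mono (suc zero)          (suc zero)          (s≤s ())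
  mono (suc zero)          (suc (suc zero))    _ = x<y
  mono (suc zero)          (suc (suc (suc zero))) _ = ℕₚ.<-trans x<y y<z
  mono (suc (suc zero))    (suc zero)          (s≤s ())
  mono (suc (suc zero))    (suc (suc zero))    (s≤s (s≤s ()))
  mono (suc (suc zero))    (suc (suc (suc zero))) _ = y<z
  mono (suc (suc (suc zero))) (suc zero)       (s≤s ())
  mono (suc (suc (suc zero))) (suc (suc zero)) (s≤s (s≤s ()))
  mono (suc (suc (suc zero))) (suc (suc (suc zero))) (s≤s (s≤s (s≤s ())))
  cancel : ∀ i j → f i < f j → i < j
  cancel i j fi<fj with <-cmp i j
  ... | tri< i<j _ _  = i<j
  ... | tri≈ _ refl _ = contradiction fi<fj (<-irrefl {x = f i} refl)
  ... | tri> _ _ j<i  = contradiction fi<fj (<-asym {x = f j} {y = f i} (mono j i j<i))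

-- Listed increasingly as `C`, `A`, `B`, `D`, the four letters map the pattern onto
-- `A ∷ B ∷ C ∷ D ∷ []`, and an increasing map keeps the order type.
2314-orderIso : ∀ {m} (A B C D : Fin m) →
  OrderIsomorphic (A ∷ B ∷ C ∷ D ∷ []) p2314 ⇔ (C < A × A < B × B < D)
2314-orderIso A B C D = mk⇔
  -- The index pairs are the positions of consecutive values in the pattern.
  (λ iso → from (iso (# 2) (# 0)) (s≤s z≤n) , from (iso (# 0) (# 1)) (s≤s (s≤s z≤n)) ,
           from (iso (# 1) (# 3)) (s≤s (s≤s (s≤s z≤n))))
  (λ (C<A , A<B , B<D) →
    from (orderIso-map (increasing-embedding C A B D C<A A<B B<D) p2314 p2314) (λ _ _ → mk⇔ id id))

2413-orderIso : ∀ {m} (A B C D : Fin m) →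
  OrderIsomorphic (A ∷ B ∷ C ∷ D ∷ []) p2413 ⇔ (C < A × A < D × D < B)
2413-orderIso A B C D = mk⇔
  (λ iso → from (iso (# 2) (# 0)) (s≤s z≤n) , from (iso (# 0) (# 3)) (s≤s (s≤s z≤n)) ,
           from (iso (# 3) (# 1)) (s≤s (s≤s (s≤s z≤n))))
  (λ (C<A , A<D , D<B) →
    from (orderIso-map (increasing-embedding C A D B C<A A<D D<B) p2413 p2413) (λ _ _ → mk⇔ id id))

later-letter : ∀ {n} (a : Fin (3 ℕ.+ n)) (b : Fin (2 ℕ.+ n)) (c : Fin (suc n)) (s : Code n) (x : Fin (3 ℕ.+ n)) →
  x ≢ a → x ≢ punchIn a b → x ≢ punchIn a (punchIn b c) →
  ∃[ j ] lookup (map (punchIn a) (map (punchIn b) (map (punchIn c) (decode s)))) j ≡ x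
later-letter a b c s x x≢A x≢B x≢C with decode-surjective (a ∷ b ∷ c ∷ s) x
... | zero              , eq = contradiction (sym eq) x≢A
... | suc zero          , eq = contradiction (sym eq) x≢B
... | suc (suc zero)    , eq = contradiction (sym eq) x≢C
... | suc (suc (suc j)) , eq = j , eq

-- At a peak `c` is below both `a` and `b`, so the two insertions leave it fixed. Conversely,
-- `punchIn b c` is below `a`, hence below `b`, which is possible only if inserting `b` did not
-- shift `c`.
peak⇔ : ∀ {n} (a : Fin (3 ℕ.+ n)) (b : Fin (2 ℕ.+ n)) (c : Fin (suc n)) →
  Peak a b c ⇔ (punchIn a (punchIn b c) < a × a < punchIn a b)
peak⇔ a b c = mk⇔
  (λ (c<a , a≤b) → from (punchIn-<⇔ a _)
      (subst (ℕ._< toℕ a) (sym (punchIn-below b c (ℕₚ.<-≤-trans c<a a≤b))) c<a) ,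
    from (punchIn->⇔ a b) a≤b)
  (λ (C<A , A<B) → peak (to (punchIn-<⇔ a _) C<A) (to (punchIn->⇔ a b) A<B))
  where
  peak : toℕ (punchIn b c) ℕ.< toℕ a → toℕ a ≤ toℕ b → Peak a b c
  peak bc<a a≤b = subst (ℕ._< toℕ a) (punchIn-below b c (to (punchIn-<⇔ b c) (ℕₚ.<-≤-trans bc<a a≤b))) bc<a , a≤b

-- The two prescribed values

maximal : PeakValue
maximal = record
  { value = λ {n} _ → fromℕ n
  ; above = λ {n} a b a≤b → subst (toℕ a ≤_) (sym (toℕ-fromℕ n)) (ℕₚ.≤-trans a≤b (toℕ≤pred[n] b))
  }

-- Junk on the largest a, which can never be at most b.
lower : ∀ {n} → Fin (suc (suc n)) → Fin (suc n)
lower         zero    = zero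
lower {zero}  (suc a) = zero
lower {suc n} (suc a) = suc (lower a)

toℕ-lower : ∀ {n} (a : Fin (suc (suc n))) (b : Fin (suc n)) → toℕ a ≤ toℕ b → toℕ (lower a) ≡ toℕ a
toℕ-lower         zero    b       a≤b       = refl
toℕ-lower {suc n} (suc a) (suc b) (s≤s a≤b) = cong suc (toℕ-lower a b a≤b)

-- The least entry that can make a peak: with `b` equal to `a`, the second letter is the successor
-- of the first and no letter fits between.
minimal : PeakValue
minimal = record
  { value = lower
  ; above = λ a b a≤b → ℕₚ.≤-reflexive (sym (toℕ-lower a b a≤b))
  }

-- The fourth letter must exceed `B`. At a peak this is impossible only when `B` is the largest
-- letter, that is, when `b` is maximal.
2314-starts⇔ : ∀ {n} (a : Fin (3 ℕ.+ n)) (b : Fin (2 ℕ.+ n)) (c : Fin (suc n)) (s : Code n) →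
  Starts p2314 (decode (a ∷ b ∷ c ∷ s)) ⇔ (Peak a b c × b ≢ fromℕ (suc n))
2314-starts⇔ {n} a b c s = mk⇔ forth back
  where
  A B C : Fin (3 ℕ.+ n)
  A = a
  B = punchIn a b
  C = punchIn a (punchIn b c)
  letter : Fin n → Fin (3 ℕ.+ n)
  letter = lookup (map (punchIn a) (map (punchIn b) (map (punchIn c) (decode s))))
  forth : Starts p2314 (decode (a ∷ b ∷ c ∷ s)) → Peak a b c × b ≢ fromℕ (suc n)
  forth (j , iso) with to (2314-orderIso A B C (letter j)) iso
  ... | C<A , A<B , B<D = from (peak⇔ a b c) (C<A , A<B) , λ b≡max →
    -- `B` is one more than `b`, so a letter above `B` leaves `b` short of its maximum.
    ℕₚ.<-irrefl (trans (cong toℕ b≡max) (toℕ-fromℕ (suc n)))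
      (ℕ.s≤s⁻¹ (ℕₚ.≤-trans
        (subst (ℕ._< toℕ (letter j)) (punchIn-above a b (to (punchIn->⇔ a b) A<B)) B<D)
        (toℕ≤pred[n] (letter j))))
  back : Peak a b c × b ≢ fromℕ (suc n) → Starts p2314 (decode (a ∷ b ∷ c ∷ s))
  back (pk@(c<a , a≤b) , b≢max) = proj₁ later , from (2314-orderIso A B C (letter (proj₁ later)))
    (C<A , A<B , subst (B <_) (sym (proj₂ later)) B<D)
    where
    D : Fin (3 ℕ.+ n)
    -- The largest letter serves: it differs from the first three, so it occurs later.
    D = fromℕ (2 ℕ.+ n)
    C<A : C < A
    C<A = proj₁ (to (peak⇔ a b c) pk)
    A<B : A < B
    A<B = proj₂ (to (peak⇔ a b c) pk)
    B<D : B < D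
    B<D = subst₂ ℕ._<_ (sym (punchIn-above a b a≤b)) (sym (toℕ-fromℕ (2 ℕ.+ n)))
      (s≤s (ℕₚ.≤∧≢⇒< (toℕ≤pred[n] b)
        λ b≡ → b≢max (toℕ-injective (trans b≡ (sym (toℕ-fromℕ (suc n)))))))
    A<D : A < D
    A<D = ℕₚ.<-trans A<B B<D
    later : ∃[ j ] letter j ≡ D
    later = later-letter a b c s D (<⇒≢ A<D ∘ sym) (<⇒≢ B<D ∘ sym) (<⇒≢ (ℕₚ.<-trans C<A A<D) ∘ sym)

-- The fourth letter must lie strictly between `A` and `B`. At a peak their values are `a` and
-- `b + 1`, so the gap is empty exactly when `b` equals `a`.
2413-starts⇔ : ∀ {n} (a : Fin (3 ℕ.+ n)) (b : Fin (2 ℕ.+ n)) (c : Fin (suc n)) (s : Code n) →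
  Starts p2413 (decode (a ∷ b ∷ c ∷ s)) ⇔ (Peak a b c × b ≢ lower a)
2413-starts⇔ {n} a b c s = mk⇔ forth back
  where
  A B C : Fin (3 ℕ.+ n)
  A = a
  B = punchIn a b
  C = punchIn a (punchIn b c)
  letter : Fin n → Fin (3 ℕ.+ n)
  letter = lookup (map (punchIn a) (map (punchIn b) (map (punchIn c) (decode s))))
  forth : Starts p2413 (decode (a ∷ b ∷ c ∷ s)) → Peak a b c × b ≢ lower a
  forth (j , iso) with to (2413-orderIso A B C (letter j)) iso
  ... | C<A , A<D , D<B with from (peak⇔ a b c) (C<A , ℕₚ.<-trans A<D D<B)
  ... | c<a , a≤b = (c<a , a≤b) , λ b≡a →
    ℕₚ.<-irrefl (sym (trans (cong toℕ b≡a) (toℕ-lower a b a≤b)))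
      (ℕₚ.<-≤-trans A<D (ℕ.s≤s⁻¹ (subst (toℕ (letter j) ℕ.<_) (punchIn-above a b a≤b) D<B)))
  back : Peak a b c × b ≢ lower a → Starts p2413 (decode (a ∷ b ∷ c ∷ s))
  back (pk@(c<a , a≤b) , b≢a) = proj₁ later , from (2413-orderIso A B C (letter (proj₁ later)))
    (C<A , subst (A <_) (sym (proj₂ later)) A<D , subst (_< B) (sym (proj₂ later)) D<B)
    where
    D : Fin (3 ℕ.+ n)
    -- The predecessor of `B`, which exceeds `A` because `b` is not `a`.
    D = inject₁ b
    C<A : C < A
    C<A = proj₁ (to (peak⇔ a b c) pk)
    A<D : A < D
    A<D = subst (toℕ a ℕ.<_) (sym (toℕ-inject₁ b))
      (ℕₚ.≤∧≢⇒< a≤b λ a≡b → b≢a (toℕ-injective (trans (sym a≡b) (sym (toℕ-lower a b a≤b)))))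
    D<B : D < B
    D<B = subst₂ ℕ._<_ (sym (toℕ-inject₁ b)) (sym (punchIn-above a b a≤b)) ℕₚ.≤-refl
    later : ∃[ j ] letter j ≡ D
    later = later-letter a b c s D (<⇒≢ A<D ∘ sym) (<⇒≢ D<B) (<⇒≢ (ℕₚ.<-trans C<A A<D) ∘ sym)

2314-criterion : CodeCriterion p2314
2314-criterion = record { peakValue = maximal ; starts⇔ = 2314-starts⇔ }

2413-criterion : CodeCriterion p2413
2413-criterion = record { peakValue = minimal ; starts⇔ = 2413-starts⇔ }

theorem3p4 : p2314 ∼des p2413
theorem3p4 (suc n) _ m = ℕₚ.≤-antisym
  (avoidersWithDes-≤ 2314-criterion 2413-criterion n m)
  (avoidersWithDes-≤ 2413-criterion 2314-criterion n m)
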